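{- $\mathrm{cov}(\mathcal{M})\leq\mathfrak{s}(\mathbb{R})$.
   Context: $\mathrm{cov}(\mathcal{M})$ is the smallest number of meager subsets of $\mathbb{R}$ whose union is $\mathbb{R}$. For infinite sets $U, A$, say $U$ splits $A$ if both $A\cap U$ and $A\setminus U$ are infinite. $\mathfrak{s}(\mathbb{R})$ is the smallest cardinality of a family $\mathcal{U}$ of open subsets of $\mathbb{R}$ (usual topology) such that every infinite $A\subseteq\mathbb{R}$ is split by some $U\in\mathcal{U}$. -}

module Defs where

open import Data.List.Base using (List)
open import Data.List.Relation.Unary.Any using (Any)
open import Data.Nat.Base as ℕ using (ℕ)
open import Data.Product.Base using (Σ-syntax; ∃-syntax; _×_)
open import Data.Rational.Base using (ℚ; 0ℚ; _<_; _≤_; _-_; ∣_∣)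
open import Function.Bundles using (_↣_)
open import Level using (0ℓ; suc)
open import Relation.Binary.Definitions using (_Respects_)
open import Relation.Nullary.Negation using (¬_)
open import Relation.Unary using (Pred; _∈_; _⊆_; _∩_; ∁; _≬_; Empty)

-- The reals are the Cauchy completion of ℚ: Cauchy sequences of rationals,
-- considered up to the setoid equality _≈_ (the difference is a null sequence).

record ℝ : Set where
  field
    seq    : ℕ → ℚ
    cauchy : ∀ ε → 0ℚ < ε → ∃[ N ] ∀ m n → N ℕ.≤ m → N ℕ.≤ n → ∣ seq m - seq n ∣ < ε

open ℝ public

infix 4 _≈_

_≈_ : ℝ → ℝ → Set
x ≈ y = ∀ ε → 0ℚ < ε → ∃[ N ] ∀ n → N ℕ.≤ n → ∣ seq x n - seq y n ∣ < ε

-- y ∈ Ball ε x says lim ∣ seq x n - seq y n ∣ < ε.  The bound δ strictly below ε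
-- is needed because a sequence of terms < ε may have limit ε.

Ball : ℚ → ℝ → Pred ℝ 0ℓ
Ball ε x y = Σ[ δ ∈ ℚ ] δ < ε × (∃[ N ] ∀ n → N ℕ.≤ n → ∣ seq x n - seq y n ∣ ≤ δ)

Interior : Pred ℝ 0ℓ → Pred ℝ 0ℓ
Interior S x = ∃[ ε ] 0ℚ < ε × Ball ε x ⊆ S

-- The adherent points: those with no ball disjoint from S, that is, the
-- complement of the exterior of S.  The double negation is what makes this a
-- complement of an open set without appeal to excluded middle.

Closure : Pred ℝ 0ℓ → Pred ℝ 0ℓ
Closure S x = ∀ ε → 0ℚ < ε → ¬ ¬ (Ball ε x ≬ S)

-- An open predicate automatically respects _≈_, as ≈-equal points lie in the
-- same balls.

Open : Pred ℝ 0ℓ → Set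
Open S = S ⊆ Interior S

NowhereDense : Pred ℝ 0ℓ → Set
NowhereDense S = Empty (Interior (Closure S))

Meager : Pred ℝ 0ℓ → Set₁
Meager S = Σ[ N ∈ (ℕ → Pred ℝ 0ℓ) ] (∀ n → NowhereDense (N n)) × (∀ {x} → x ∈ S → ∃[ n ] x ∈ N n)

-- Only finitely many elements up to _≈_.  The list may contain points outside S.

Finite : Pred ℝ 0ℓ → Set
Finite S = Σ[ xs ∈ List ℝ ] (∀ {x} → x ∈ S → Any (x ≈_) xs)

Infinite : Pred ℝ 0ℓ → Set
Infinite S = ¬ Finite S

_Splits_ : Pred ℝ 0ℓ → Pred ℝ 0ℓ → Set
U Splits A = Infinite (A ∩ U) × Infinite (A ∩ ∁ U)

-- Types in Set stand for cardinals and _↣_ for ≤.  Families are indexed, possibly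
-- with repetitions; this leaves the smallest size of a family unchanged, since a
-- repetition-free subfamily is indexed by a subset of the index type.
-- A predicate on ℝ is a subset of the real line when it respects _≈_.

MeagerCover : Set → Set₁
MeagerCover κ = Σ[ M ∈ (κ → Pred ℝ 0ℓ) ]
  (∀ i → M i Respects _≈_) × (∀ i → Meager (M i)) × (∀ x → ∃[ i ] x ∈ M i)

OpenSplittingFamily : Set → Set₁
OpenSplittingFamily κ = Σ[ U ∈ (κ → Pred ℝ 0ℓ) ]
  (∀ i → Open (U i)) × (∀ A → A Respects _≈_ → Infinite A → ∃[ i ] U i Splits A)

-- That a nonempty class of cardinals has a smallest element needs choice, so a claim
-- about IsSmallest elements should be paired with one about P itself if it is not
-- to depend on their existence.

IsSmallest : Pred Set (suc 0ℓ) → Pred Set (suc 0ℓ)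
IsSmallest P κ = P κ × (∀ μ → P μ → κ ↣ μ)

Is-cov[𝓜] : Pred Set (suc 0ℓ)
Is-cov[𝓜] = IsSmallest MeagerCover

Is-𝔰[ℝ] : Pred Set (suc 0ℓ)
Is-𝔰[ℝ] = IsSmallest OpenSplittingFamily

{-# OPTIONS --safe #-}

-- If a sequence of distinct points converges to x, then an open U splitting its
-- range has x in its closure, since infinitely many terms lie in U, but x ∉ U, since
-- infinitely many lie outside U.  So x lies on the boundary of U, which is nowhere
-- dense, and the boundaries of the members of an open splitting family cover ℝ.

module Submission where

open import Data.Fin.Base using (toℕ)
open import Data.Fin.Properties using (pigeonhole)
open import Data.Integer.Base as ℤ using (+_)
open import Data.List.Base using (length; lookup; applyUpTo)
open import Data.List.Relation.Unary.Any as Any using ()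
open import Data.List.Relation.Unary.Any.Properties using (applyUpTo⁺; lookup-index)
open import Data.Nat.Base as ℕ using (ℕ; suc)
import Data.Nat.Coprimality as Coprimality
import Data.Nat.Properties as ℕ
open import Data.Product.Base using (Σ-syntax; ∃-syntax; _×_; _,_)
open import Data.Rational.Base
open import Data.Rational.Properties
open import Algebra.Properties.AbelianGroup +-0-abelianGroup using (xyx⁻¹≈y)
open import Algebra.Properties.Group +-0-group
  using (//-rightDividesˡ; //-rightDividesʳ; ⁻¹-anti-homo-∙; ⁻¹-anti-homo-//)
open import Function.Base using (_∘_)
open import Function.Bundles using (_↣_)
open import Function.Construct.Identity using (↣-id)
open import Relation.Binary.Definitions using (_Respects_)
open import Relation.Binary.PropositionalEquality
open import Relation.Nullary.Decidable.Core using (yes; no; decidable-stable)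
open import Relation.Nullary.Negation using (¬_; contradiction)
open import Relation.Unary using (Pred; _∈_; _∉_; _∩_; ∁)
open import Level using (0ℓ)
open import Defs

p<q⇒0<q-p : ∀ {p q} → p < q → 0ℚ < q - p
p<q⇒0<q-p {p} {q} p<q = subst (_< q - p) (+-inverseʳ p) (+-monoˡ-< (- p) p<q)

p+[q-p]≡q : ∀ p q → p + (q - p) ≡ q
p+[q-p]≡q p q = trans (+-comm p (q - p)) (//-rightDividesˡ p q)

[p-q]+[q-r]≡p-r : ∀ p q r → (p - q) + (q - r) ≡ p - r
[p-q]+[q-r]≡p-r p q r =
  trans (sym (+-assoc (p - q) q (- r))) (cong (_- r) (//-rightDividesˡ q p))

[p+r]-[q+r]≡p-q : ∀ r p q → (p + r) - (q + r) ≡ p - q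
[p+r]-[q+r]≡p-q r p q = begin
  (p + r) - (q + r)      ≡⟨ cong (λ t → (p + r) + t) (⁻¹-anti-homo-∙ q r) ⟩
  (p + r) + (- r - q)    ≡⟨ +-assoc (p + r) (- r) (- q) ⟨
  ((p + r) - r) - q      ≡⟨ cong (_- q) (//-rightDividesʳ r p) ⟩
  p - q                  ∎
  where open ≡-Reasoning

[r+p]-[r+q]≡p-q : ∀ r p q → (r + p) - (r + q) ≡ p - q
[r+p]-[r+q]≡p-q r p q =
  trans (cong₂ _-_ (+-comm r p) (+-comm r q)) ([p+r]-[q+r]≡p-q r p q)

∣p-r∣≤∣p-q∣+∣q-r∣ : ∀ p q r → ∣ p - r ∣ ≤ ∣ p - q ∣ + ∣ q - r ∣
∣p-r∣≤∣p-q∣+∣q-r∣ p q r = subst (λ t → ∣ t ∣ ≤ ∣ p - q ∣ + ∣ q - r ∣)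
  ([p-q]+[q-r]≡p-r p q r) (∣p+q∣≤∣p∣+∣q∣ (p - q) (q - r))

∣p-q∣≡∣q-p∣ : ∀ p q → ∣ p - q ∣ ≡ ∣ q - p ∣
∣p-q∣≡∣q-p∣ p q = trans (sym (∣-p∣≡∣p∣ (p - q))) (cong ∣_∣ (⁻¹-anti-homo-// p q))

-- Taking `ε` to be `∣ p - q ∣` itself gives a contradiction when `p` and `q` differ. Equality on ℚ
-- is decidable, so this suffices constructively.
∣p-q∣<ε⇒p≡q : ∀ p q → (∀ ε → 0ℚ < ε → ∣ p - q ∣ < ε) → p ≡ q
∣p-q∣<ε⇒p≡q p q small = decidable-stable (p ≟ q) λ p≢q →
  <-irrefl refl (small ∣ p - q ∣ (≰⇒> λ ≤0 → p≢q (begin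
    p            ≡⟨ p+[q-p]≡q q p ⟨
    q + (p - q)  ≡⟨ cong (λ t → q + t) (∣p∣≡0⇒p≡0 (p - q) (≤-antisym ≤0 (0≤∣p∣ (p - q)))) ⟩
    q + 0ℚ       ≡⟨ +-identityʳ q ⟩
    q            ∎)))
  where open ≡-Reasoning

≈-refl : ∀ x → x ≈ x
≈-refl x ε 0<ε = 0 , λ n _ → subst (λ t → ∣ t ∣ < ε) (sym (+-inverseʳ (seq x n))) 0<ε

≈-sym : ∀ {x y} → x ≈ y → y ≈ x
≈-sym {x} {y} x≈y ε 0<ε with N , x~y ← x≈y ε 0<ε =
  N , λ n N≤n → subst (_< ε) (∣p-q∣≡∣q-p∣ (seq x n) (seq y n)) (x~y n N≤n)

Ball-triangle : ∀ {ε η x y z} → y ∈ Ball ε x → z ∈ Ball η y → z ∈ Ball (ε + η) x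
Ball-triangle {x = x} {y} {z} (δ , δ<ε , M , x~y) (γ , γ<η , N , y~z) =
  δ + γ , +-mono-< δ<ε γ<η , M ℕ.⊔ N , λ n M⊔N≤n → ≤-trans
    (∣p-r∣≤∣p-q∣+∣q-r∣ (seq x n) (seq y n) (seq z n))
    (+-mono-≤ (x~y n (ℕ.m⊔n≤o⇒m≤o M N M⊔N≤n)) (y~z n (ℕ.m⊔n≤o⇒n≤o M N M⊔N≤n)))

Ball-open : ∀ {ε x} → Open (Ball ε x)
-- The point `y` lies even in `Ball m x`, which leaves the radius `ε - m` free around `y`.
Ball-open {ε} {x} {y} (δ , δ<ε , x~y) with m , δ<m , m<ε ← <-dense δ<ε =
  ε - m , p<q⇒0<q-p m<ε , λ {z} z∈B →
    subst (λ r → z ∈ Ball r x) (p+[q-p]≡q m ε)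
      (Ball-triangle {x = x} {y} {z} (δ , δ<m , x~y) z∈B)

≈⇒∈Ball : ∀ {ε x y} → 0ℚ < ε → x ≈ y → y ∈ Ball ε x
≈⇒∈Ball 0<ε x≈y with δ , 0<δ , δ<ε ← <-dense 0<ε with N , x~y ← x≈y δ 0<δ =
  δ , δ<ε , N , λ n N≤n → <⇒≤ (x~y n N≤n)

∈Ball⇒≈ : ∀ {x y} → (∀ ε → 0ℚ < ε → y ∈ Ball ε x) → x ≈ y
∈Ball⇒≈ y∈B ε 0<ε with δ , δ<ε , N , x~y ← y∈B ε 0<ε =
  N , λ n N≤n → ≤-<-trans (x~y n N≤n) δ<ε

≈-trans : ∀ {x y z} → x ≈ y → y ≈ z → x ≈ z
≈-trans {x} {y} {z} x≈y y≈z = ∈Ball⇒≈ {x} {z} λ ε 0<ε →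
  -- Any `δ` strictly between 0 and `ε` splits `ε` into two positive radii `δ` and `ε - δ`.
  let δ , 0<δ , δ<ε = <-dense 0<ε in
  subst (λ r → z ∈ Ball r x) (p+[q-p]≡q δ ε)
    (Ball-triangle {x = x} {y} {z}
      (≈⇒∈Ball {x = x} {y} 0<δ x≈y) (≈⇒∈Ball {x = y} {z} (p<q⇒0<q-p δ<ε) y≈z))

Open⇒Respects-≈ : ∀ {S} → Open S → S Respects _≈_
Open⇒Respects-≈ S-open {x} {y} x≈y x∈S with ε , 0<ε , B⊆S ← S-open x∈S =
  B⊆S {y} (≈⇒∈Ball {x = x} {y} 0<ε x≈y)

Closure-Respects-≈ : ∀ S → Closure S Respects _≈_
Closure-Respects-≈ S {x} {y} x≈y x∈S⁻ ε 0<ε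
  with η , 0<η , B⊆B ← Ball-open {ε} {y} {x} (≈⇒∈Ball {x = y} {x} 0<ε (≈-sym {x} {y} x≈y)) =
  λ disjoint → x∈S⁻ η 0<η λ (z , z∈B , z∈S) → disjoint (z , B⊆B {z} z∈B , z∈S)

-- For open S this is the topological boundary.
Boundary : Pred ℝ 0ℓ → Pred ℝ 0ℓ
Boundary S = Closure S ∩ ∁ S

Boundary-Respects-≈ : ∀ {S} → Open S → Boundary S Respects _≈_
Boundary-Respects-≈ {S} S-open {x} {y} x≈y (x∈S⁻ , x∉S) =
  Closure-Respects-≈ S {x} {y} x≈y x∈S⁻ ,
  λ y∈S → x∉S (Open⇒Respects-≈ S-open {y} {x} (≈-sym {x} {y} x≈y) y∈S)

-- A ball inside the closure of the boundary contains a boundary point `y`, and near `y` a point `z`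
-- of `S`. Some ball around `z` lies in `S`, hence misses the boundary, although `z` is adherent to
-- it. The goal is a negation, so the doubly negated witnesses can be used.
Boundary-nowhereDense : ∀ {S} → Open S → NowhereDense (Boundary S)
Boundary-nowhereDense S-open x (ε , 0<ε , B⊆∂S⁻) =
  B⊆∂S⁻ {x} (≈⇒∈Ball {x = x} {x} 0<ε (≈-refl x)) ε 0<ε λ (y , y∈B , y∈S⁻ , _) →
  let η , 0<η , B′⊆B = Ball-open {ε} {x} {y} y∈B in
  y∈S⁻ η 0<η λ (z , z∈B′ , z∈S) →
  let θ , 0<θ , B″⊆S = S-open z∈S in
  B⊆∂S⁻ {z} (B′⊆B {z} z∈B′) θ 0<θ λ (w , w∈B″ , _ , w∉S) →
  w∉S (B″⊆S {w} w∈B″)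

nowhereDense⇒meager : ∀ {S} → NowhereDense S → Meager S
nowhereDense⇒meager {S} S-nd = (λ _ → S) , (λ _ → S-nd) , λ x∈S → 0 , x∈S

-- Closed under `_≈_`, since a splitting family only has to split predicates that respect it.
Range : (ℕ → ℝ) → Pred ℝ 0ℓ
Range f y = ∃[ n ] y ≈ f n

Range-Respects-≈ : ∀ f → Range f Respects _≈_
Range-Respects-≈ f {y} {z} y≈z (n , y≈fn) =
  n , ≈-trans {z} {y} {f n} (≈-sym {y} {z} y≈z) y≈fn

-- Among the first `length xs + 1` terms, two would be matched to the same entry of a list `xs`
-- covering the range.
Range-infinite : ∀ f → (∀ {m n} → f m ≈ f n → m ≡ n) → Infinite (Range f)
Range-infinite f f-injective (xs , covers) =
  let i , j , i<j , same = pigeonhole (ℕ.n<1+n (length xs)) (Any.index ∘ inList ∘ toℕ)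
      x = lookup xs (Any.index (inList (toℕ j)))
      fi≈x = subst (λ k → f (toℕ i) ≈ lookup xs k) same (lookup-index (inList (toℕ i)))
      fj≈x = lookup-index (inList (toℕ j))
  in ℕ.<⇒≢ i<j (f-injective (≈-trans {f (toℕ i)} {x} {f (toℕ j)}
       fi≈x (≈-sym {f (toℕ j)} {x} fj≈x)))
  where
  inList : ∀ n → Any.Any (f n ≈_) xs
  inList n = covers {f n} (n , ≈-refl (f n))

-- Otherwise the first `N` terms alone would list `Range f ∩ S`.
infinite⇒meets-tail : ∀ f S N → Infinite (Range f ∩ S) →
  ¬ (∀ {n y} → N ℕ.≤ n → y ≈ f n → y ∉ S)
infinite⇒meets-tail f S N infinite tail∌ = infinite (applyUpTo f N , covers)
  where
  covers : ∀ {y} → y ∈ Range f ∩ S → Any.Any (y ≈_) (applyUpTo f N)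
  covers {y} ((n , y≈fn) , y∈S) with n ℕ.<? N
  ... | yes n<N = applyUpTo⁺ f y≈fn n<N
  ... | no  n≮N = contradiction y∈S (tail∌ {n} {y} (ℕ.≮⇒≥ n≮N) y≈fn)

-- Convergence is stated for all `y ≈ f n` because the points of `Range f` are terms only up to
-- `_≈_`.
_⟶_ : (ℕ → ℝ) → ℝ → Set
f ⟶ x = ∀ ε → 0ℚ < ε → ∃[ N ] ∀ {n y} → N ℕ.≤ n → y ≈ f n → y ∈ Ball ε x

-- A ball around `x` that missed `U`, or lay inside `U`, would contain a tail of `f`, leaving at
-- most finitely many terms on one side of the split.
splits⇒limit∈Boundary : ∀ {f x U} → f ⟶ x → Open U → U Splits Range f → x ∈ Boundary U
splits⇒limit∈Boundary {f} {x} {U} f⟶x U-open (inside , outside) = x∈U⁻ , x∉U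
  where
  x∈U⁻ : x ∈ Closure U
  x∈U⁻ ε 0<ε disjoint with N , tail ← f⟶x ε 0<ε =
    infinite⇒meets-tail f U N inside λ {n} {y} N≤n y≈fn y∈U →
      disjoint (y , tail {n} {y} N≤n y≈fn , y∈U)
  x∉U : x ∉ U
  x∉U x∈U with ε , 0<ε , B⊆U ← U-open x∈U with N , tail ← f⟶x ε 0<ε =
    infinite⇒meets-tail f (∁ U) N outside λ {n} {y} N≤n y≈fn y∉U →
      y∉U (B⊆U {y} (tail {n} {y} N≤n y≈fn))

-- The field `n` of `mkℚ` encodes the denominator `n + 1`. Building the reduced fraction directly
-- makes injectivity a matter of constructors.
1/1+ : ℕ → ℚ
1/1+ n = mkℚ (+ 1) n (Coprimality.1-coprimeTo (suc n))

1/1+-injective : ∀ {m n} → 1/1+ m ≡ 1/1+ n → m ≡ n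
1/1+-injective refl = refl

1/1+-null : ∀ ε → 0ℚ < ε → ∃[ N ] ∀ {n} → N ℕ.≤ n → 1/1+ n < ε
1/1+-null (mkℚ (+ ℕ.zero)  d c) 0<ε = contradiction (positive 0<ε) λ ()
-- Here `ε` is `(a + 1) / (d + 1)`, which is at least `1 / (d + 1)`. The chain is the
-- cross-multiplied inequality.
1/1+-null (mkℚ (+ suc a)  d c) 0<ε = suc d , λ {n} d<n → *<* (ℤ.+<+ (begin-strict
  suc d ℕ.+ 0        ≡⟨ ℕ.+-identityʳ (suc d) ⟩
  suc d              ≤⟨ d<n ⟩
  n                  <⟨ ℕ.n<1+n n ⟩
  suc n              ≤⟨ ℕ.m≤m+n (suc n) (a ℕ.* suc n) ⟩
  suc a ℕ.* suc n    ∎))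
  where open ℕ.≤-Reasoning
1/1+-null (mkℚ ℤ.-[1+ a ] d c) 0<ε = contradiction (positive 0<ε) λ ()

_+ʳ_ : ℝ → ℚ → ℝ
seq    (x +ʳ q) n = seq x n + q
cauchy (x +ʳ q) ε 0<ε with N , close ← cauchy x ε 0<ε =
  N , λ m n N≤m N≤n → subst (λ t → ∣ t ∣ < ε)
    (sym ([p+r]-[q+r]≡p-q q (seq x m) (seq x n))) (close m n N≤m N≤n)

-- The termwise difference of the two translates is constantly `p - q`, so a single index for each
-- `ε` bounds it.
+ʳ-cancelˡ : ∀ x p q → (x +ʳ p) ≈ (x +ʳ q) → p ≡ q
+ʳ-cancelˡ x p q x+p≈x+q = ∣p-q∣<ε⇒p≡q p q λ ε 0<ε →
  let N , close = x+p≈x+q ε 0<ε in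
  subst (λ t → ∣ t ∣ < ε) ([r+p]-[r+q]≡p-q (seq x N) p q) (close N ℕ.≤-refl)

+ʳ-∈Ball : ∀ {ε} x q → ∣ q ∣ < ε → (x +ʳ q) ∈ Ball ε x
+ʳ-∈Ball x q ∣q∣<ε = ∣ q ∣ , ∣q∣<ε , 0 , λ n _ → ≤-reflexive (begin
  ∣ seq x n - (seq x n + q) ∣  ≡⟨ ∣p-q∣≡∣q-p∣ (seq x n) (seq x n + q) ⟩
  ∣ (seq x n + q) - seq x n ∣  ≡⟨ cong ∣_∣ (xyx⁻¹≈y (seq x n) q) ⟩
  ∣ q ∣                        ∎)
  where open ≡-Reasoning

approach : ℝ → ℕ → ℝ
approach x n = x +ʳ 1/1+ n

approach-injective : ∀ x {m n} → approach x m ≈ approach x n → m ≡ n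
approach-injective x {m} {n} = 1/1+-injective ∘ +ʳ-cancelˡ x (1/1+ m) (1/1+ n)

approach-⟶ : ∀ x → approach x ⟶ x
approach-⟶ x ε 0<ε with N , small ← 1/1+-null ε 0<ε =
  N , λ {n} {y} N≤n y≈fn →
    Open⇒Respects-≈ (λ {z} → Ball-open {ε} {x} {z}) {approach x n} {y}
      (≈-sym {y} {approach x n} y≈fn) (+ʳ-∈Ball x (1/1+ n) (small N≤n))

boundaryCover : ∀ {μ} → OpenSplittingFamily μ → MeagerCover μ
boundaryCover (U , U-open , U-splits) =
  (λ i → Boundary (U i)) ,
  (λ i {x} {y} → Boundary-Respects-≈ (U-open i) {x} {y}) ,
  (λ i → nowhereDense⇒meager (Boundary-nowhereDense (U-open i))) ,
  λ x → let A = approach x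
            i , Uᵢ-splits-A = U-splits (Range A)
              (λ {y} {z} → Range-Respects-≈ A {y} {z})
              (Range-infinite A λ {m} {n} → approach-injective x {m} {n})
        in i , splits⇒limit∈Boundary {A} (approach-⟶ x) (U-open i) Uᵢ-splits-A

theorem3p1 : (∀ (κ μ : Set) → Is-cov[𝓜] κ → Is-𝔰[ℝ] μ → κ ↣ μ)
    × (∀ (μ : Set) → OpenSplittingFamily μ → Σ[ κ ∈ Set ] (MeagerCover κ × (κ ↣ μ)))
theorem3p1 =
  -- The boundaries are indexed by `μ` itself, so minimality of `κ` among covers gives the
  -- injection.
  (λ κ μ (_ , κ-least) (μ-splits , _) → κ-least μ (boundaryCover μ-splits)) ,
  λ μ μ-splits → μ , boundaryCover μ-splits , ↣-id μ
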